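{- The number $R_3(L)$ satisfies $R_3(L) \leq 1573$.
   Context: For a positive integer $n$, the $n \times n$ integer grid is $[n]\times[n]=\{(i,j): 1\le i,j\le n\}$, where $(i,j)$ is the point in row $i$ (rows counted downward) and column $j$ (columns counted left to right). Given a coloring of $[n]\times[n]$ with $k$ colors (an arbitrary map from $[n]\times[n]$ to a set of $k$ colors), a monochromatic $L$ is a set of three points $\{(x,y),(x+d,y),(x+d,y+d)\}\subseteq [n]\times[n]$, with $d$ a positive integer, all having the same color. For a positive integer $k$, $R_k(L)$ denotes the least positive integer $n$ such that every $k$-coloring of $[n]\times[n]$ contains a monochromatic $L$ (it exists by the Gallai-Witt theorem). -}

module Defs where

open import Data.Nat.Base using (ℕ; _+_; _≤_; _>_)
open import Data.Fin.Base using (Fin; toℕ)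
open import Data.Product.Base using (_×_; _,_; ∃-syntax)
open import Relation.Binary.PropositionalEquality.Core using (_≡_)

-- The grid [n] × [n] as (row , column), with coordinates 0, …, n - 1 in place
-- of 1, …, n; the shift does not matter, as an L is translation-invariant.
Grid : ℕ → Set
Grid n = Fin n × Fin n

Coloring : ℕ → ℕ → Set
Coloring k n = Grid n → Fin k

-- p, q, r are (x , y), (x + d , y), (x + d , y + d) for some d > 0.
-- The addition is in ℕ, so that it cannot wrap around.
IsL : ∀ {n} → Grid n → Grid n → Grid n → Set
IsL p q r = ∃[ x ] ∃[ y ] ∃[ d ]
  d > 0 × p at (x , y) × q at (x + d , y) × r at (x + d , y + d)
  where
  _at_ : ∀ {n} → Grid n → ℕ × ℕ → Set
  (i , j) at (a , b) = toℕ i ≡ a × toℕ j ≡ b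

HasMonochromaticL : ∀ {k n} → Coloring k n → Set
HasMonochromaticL c = ∃[ p ] ∃[ q ] ∃[ r ] IsL p q r × c p ≡ c q × c q ≡ c r

Unavoidable : ℕ → ℕ → Set
Unavoidable k n = (c : Coloring k n) → HasMonochromaticL c

-- "R_k(L) = n", as a relation: defining R_k(L) as a function of k would
-- require its existence for every k, i.e. the Gallai-Witt theorem.
record IsRamseyL (k n : ℕ) : Set where
  field
    positive    : n > 0
    unavoidable : Unavoidable k n
    least       : ∀ m → m > 0 → Unavoidable k m → n ≤ m

-- Write κ s t for the color of (s + t , t), so that an L is a corner (s , t),
-- (s + d , t), (s , t + d).  Every seven consecutive points of the diagonal s = 0
-- contain at least five monochromatic pairs; counting pairs over all such windows,
-- some difference d and colors c ≢ c′ admit 63 positions a at which (0 , a) and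
-- (0 , a + d) have color c and (d , a) has color c′.  For two such positions a and
-- a + e the point (d + e , a) can have neither color c nor c′, so it has the third
-- color.  Since 63 · 62 > 2 · 1573, the positions contain a, a + e, a + f and
-- a + e + f with e, f > 0, and then (d + e , a), (d + e , a + f) and
-- (d + e + f , a) form a corner of the third color.
module Submission where

open import Data.Bool.Base using (true; false)
open import Data.Empty using (⊥)
open import Data.Fin.Base as Fin using (Fin; toℕ; fromℕ<; punchIn; combine; remQuot; finToFun; funToFin)
open import Data.Fin.Properties as Fin using (all?; pigeonhole; toℕ<n)
open import Data.List.Base using (List; []; _∷_; length; map; filter; lookup; allFin; upTo; cartesianProduct)
open import Data.List.Membership.Propositional using (_∈_; find)
open import Data.List.Membership.Propositional.Properties
  using (∈-filter⁺; ∈-filter⁻; ∈-cartesianProduct⁺; ∈-allFin; ∈-length; ∈-lookup)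
open import Data.List.Properties using (length-map; length-upTo; filter-≐)
import Data.List.Relation.Unary.All as All
open import Data.List.Relation.Unary.All using (All; []; _∷_)
import Data.List.Relation.Unary.All.Properties as All
open import Data.List.Relation.Unary.Any using (any?)
open import Data.List.Relation.Unary.AllPairs using (_∷_)
open import Data.List.Relation.Unary.Unique.Propositional using (Unique)
import Data.List.Relation.Unary.Unique.Propositional.Properties as Unique
open import Data.Nat.Base
open import Data.Nat.DivMod using (_mod_; m<n⇒m%n≡m)
open import Data.Nat.Induction using (<-rec)
open import Data.Nat.ListAction using (sum)
open import Data.Nat.Properties
open import Data.Nat.Tactic.RingSolver using (solve-∀)
open import Data.Product.Base using (_×_; _,_; ∃-syntax; proj₁; proj₂; uncurry)
open import Data.Sum.Base using (inj₁; inj₂)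
open import Data.Vec.Base as Vec using (Vec; []; _∷_)
open import Data.Vec.Properties using (lookup∘tabulate)
open import Function.Base using (_∘_; _$_)
open import Relation.Binary.PropositionalEquality
open import Relation.Nullary using (Dec; yes; no; does; ¬_; contradiction)
open import Relation.Nullary.Decidable using (map′; from-yes; decidable-stable; ¬?; _×-dec_; _→-dec_)
open import Relation.Unary using (Decidable)

open import Defs

-- Double counting.

module _ {A B : Set} {R : A → B → Set} (R? : ∀ x y → Dec (R x y)) where

  count-swap : ∀ xs ys →
    sum (map (λ x → length (filter (R? x) ys)) xs) ≡
    sum (map (λ y → length (filter (λ x → R? x y) xs)) ys)
  count-swap []       ys = zeros ys
    where
    zeros : ∀ ys → 0 ≡ sum (map (λ y → length (filter (λ x → R? x y) [])) ys)
    zeros []       = refl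
    zeros (_ ∷ ys) = zeros ys
  count-swap (x ∷ xs) ys = trans (cong (length (filter (R? x) ys) +_) (count-swap xs ys)) (insert ys)
    where
    col : B → ℕ
    col y = length (filter (λ x → R? x y) xs)

    swap : ∀ a b c → a + (b + c) ≡ b + (a + c)
    swap = solve-∀

    insert : ∀ ys → length (filter (R? x) ys) + sum (map col ys) ≡
                    sum (map (λ y → length (filter (λ x → R? x y) (x ∷ xs))) ys)
    insert []       = refl
    insert (y ∷ ys) with does (R? x y) | insert ys
    ... | true  | ih = cong suc (trans (swap (length (filter (R? x) ys)) (col y) _) (cong (col y +_) ih))
    ... | false | ih = trans (swap (length (filter (R? x) ys)) (col y) _) (cong (col y +_) ih)

  -- Averaging: if every `y` were related to at most `m` of the `xs`, the related pairs would number
  -- at most `length ys * m`, yet each `x` contributes at least `r`.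
  popular : ∀ r m xs ys → (∀ x → x ∈ xs → r ≤ length (filter (R? x) ys)) →
            length ys * m < length xs * r →
            ∃[ y ] y ∈ ys × m < length (filter (λ x → R? x y) xs)
  popular r m xs ys r≤ few with any? (λ y → m <? length (filter (λ x → R? x y) xs)) ys
  ... | yes ∃y = find ∃y
  ... | no ∄y  = contradiction few $ ≤⇒≯ $ begin
    length xs * r                                          ≤⟨ sum-lower xs (All.tabulate (r≤ _)) ⟩
    sum (map (λ x → length (filter (R? x) ys)) xs)         ≡⟨ count-swap xs ys ⟩
    sum (map (λ y → length (filter (λ x → R? x y) xs)) ys) ≤⟨ sum-upper ys (All.map ≮⇒≥ (All.¬Any⇒All¬ ys ∄y)) ⟩
    length ys * m                                          ∎
    where
    open ≤-Reasoning

    sum-lower : ∀ {C : Set} {f : C → ℕ} zs → All (λ z → r ≤ f z) zs → length zs * r ≤ sum (map f zs)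
    sum-lower []       []       = z≤n
    sum-lower (_ ∷ zs) (p ∷ ps) = +-mono-≤ p (sum-lower zs ps)

    sum-upper : ∀ {C : Set} {f : C → ℕ} zs → All (λ z → f z ≤ m) zs → sum (map f zs) ≤ length zs * m
    sum-upper []       []       = z≤n
    sum-upper (_ ∷ zs) (p ∷ ps) = +-mono-≤ p (sum-upper zs ps)

-- Parallelograms in dense sets of natural numbers.

lookup-injective : ∀ {A : Set} {xs : List A} → Unique xs → ∀ i j → lookup xs i ≡ lookup xs j → i ≡ j
lookup-injective (_ ∷ _)     Fin.zero    Fin.zero    _  = refl
lookup-injective (x∉xs ∷ _)  Fin.zero    (Fin.suc j) eq = contradiction eq (All.lookup x∉xs (∈-lookup j))
lookup-injective (x∉xs ∷ _)  (Fin.suc i) Fin.zero    eq = contradiction (sym eq) (All.lookup x∉xs (∈-lookup i))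
lookup-injective (_ ∷ xs!)   (Fin.suc i) (Fin.suc j) eq = cong Fin.suc (lookup-injective xs! i j eq)

-- `e` and `f` may be equal: the corner built from them in the end has size `f` and does not
-- degenerate.
Parallelogram : (ℕ → Set) → Set
Parallelogram P = ∃[ a ] ∃[ e ] ∃[ f ] 0 < e × 0 < f × P a × P (a + e) × P (a + f) × P (a + e + f)

opposite : ∀ {x y z w} → x < z → x + w ≡ y + z → y < w
opposite {y = y} {z} x<z eq =
  ≰⇒> λ w≤y → <-irrefl (trans eq (+-comm y z)) (+-mono-<-≤ x<z w≤y)

parallelogram-< : ∀ {P : ℕ → Set} {x y z w} → x < y → x < z → x + w ≡ y + z →
                  P x → P y → P z → P w → Parallelogram P
parallelogram-< {P} {x} {w = w} x<y x<z eq px py pz pw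
  with e , refl ← m≤n⇒∃[o]m+o≡n (<⇒≤ x<y) | f , refl ← m≤n⇒∃[o]m+o≡n (<⇒≤ x<z) =
  x , e , f , positive x<y , positive x<z , px , py , pz ,
  subst P (+-cancelˡ-≡ x _ _ (trans eq (rearrange x e f))) pw
  where
  positive : ∀ {d} → x < x + d → 0 < d
  positive {d} lt = +-cancelˡ-< x 0 d (subst (_< x + d) (sym (+-identityʳ x)) lt)

  rearrange : ∀ x e f → (x + e) + (x + f) ≡ x + (x + e + f)
  rearrange = solve-∀

-- Equal sums put the least and the greatest of the four numbers on the same side, so whichever is
-- least can serve as the base point `a`.
parallelogram : ∀ {P : ℕ → Set} {x y z w} → x ≢ y → x ≢ z → x + w ≡ y + z →
                P x → P y → P z → P w → Parallelogram P
parallelogram {P} {x} {y} {z} {w} x≢y x≢z eq px py pz pw with ≤-total x y | ≤-total x z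
... | inj₁ x≤y | inj₁ x≤z = parallelogram-< (≤∧≢⇒< x≤y x≢y) (≤∧≢⇒< x≤z x≢z) eq px py pz pw
... | inj₂ y≤x | inj₁ x≤z = parallelogram-< (≤∧≢⇒< y≤x (≢-sym x≢y)) (opposite (≤∧≢⇒< x≤z x≢z) eq)
                              (sym eq) py px pw pz
... | inj₁ x≤y | inj₂ z≤x = parallelogram-< (≤∧≢⇒< z≤x (≢-sym x≢z)) (opposite (≤∧≢⇒< x≤y x≢y) eq′)
                              (sym eq′) pz px pw py
  where eq′ = trans eq (+-comm y z)
... | inj₂ y≤x | inj₂ z≤x = parallelogram-< (opposite (≤∧≢⇒< z≤x (≢-sym x≢z)) (trans (+-comm z y) eq′))
                              (opposite (≤∧≢⇒< y≤x (≢-sym x≢y)) eq′)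
                              (trans (+-comm w x) eq) pw py pz px
  where eq′ = trans (sym eq) (+-comm x w)

-- The ordered pairs of distinct elements of xs outnumber the possible values of
-- their differences x - y, shifted by M to be natural numbers.
dense⇒parallelogram : ∀ {P : ℕ → Set} M xs → suc (M + M) < length xs * pred (length xs) →
                      Unique xs → All (_≤ M) xs → All P xs → Parallelogram P
dense⇒parallelogram {P} M xs@(_ ∷ xs′) many xs! xs≤M Pxs = result
  where
  l : ℕ
  l = length xs′

  g : Fin (suc l) → ℕ
  g = lookup xs

  g-injective : ∀ i j → g i ≡ g j → i ≡ j
  g-injective = lookup-injective xs!

  g≤M : ∀ i → g i ≤ M
  g≤M i = All.lookup xs≤M (∈-lookup i)

  Pg : ∀ i → P (g i)
  Pg i = All.lookup Pxs (∈-lookup i)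

  -- `punchIn i` runs through the indices other than `i`, so the domain encodes the ordered pairs of
  -- distinct indices.
  difference : Fin (suc l) × Fin l → ℕ
  difference (i , j) = g i + (M ∸ g (punchIn i j))

  bound : ∀ ij → difference ij < suc (M + M)
  bound (i , j) = s≤s (+-mono-≤ (g≤M i) (m∸n≤m M (g (punchIn i j))))

  cross : ∀ {a b a′ b′} → b ≤ M → b′ ≤ M → a + (M ∸ b) ≡ a′ + (M ∸ b′) → a + b′ ≡ b + a′
  cross {a} {b} {a′} {b′} b≤M b′≤M eq = +-cancelʳ-≡ M _ _ $ begin
    a + b′ + M               ≡⟨ cong (a + b′ +_) (m+[n∸m]≡n b≤M) ⟨
    a + b′ + (b + (M ∸ b))   ≡⟨ shuffle a b b′ (M ∸ b) ⟩
    a + (M ∸ b) + (b + b′)   ≡⟨ cong (_+ (b + b′)) eq ⟩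
    a′ + (M ∸ b′) + (b + b′) ≡⟨ shuffle′ a′ b b′ (M ∸ b′) ⟩
    b + a′ + (b′ + (M ∸ b′)) ≡⟨ cong (b + a′ +_) (m+[n∸m]≡n b′≤M) ⟩
    b + a′ + M               ∎
    where
    open ≡-Reasoning

    shuffle : ∀ a b b′ u → a + b′ + (b + u) ≡ a + u + (b + b′)
    shuffle = solve-∀

    shuffle′ : ∀ a b b′ u → a + u + (b + b′) ≡ b + a + (b′ + u)
    shuffle′ = solve-∀

  -- If the first entries agreed, the equal sums would make the second entries agree too, and the
  -- two pairs would coincide.
  distinct : ∀ {i i′} {j j′ : Fin l} → (i , j) ≢ (i′ , j′) →
             g i + g (punchIn i′ j′) ≡ g (punchIn i j) + g i′ → g i ≢ g i′
  distinct {i} {i′} {j} {j′} ij≢ eq gi≡gi′ with refl ← g-injective i i′ gi≡gi′ =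
    ij≢ (cong (i ,_) (sym (Fin.punchIn-injective i j′ j (g-injective _ _
      (+-cancelˡ-≡ (g i) _ _ (trans eq (+-comm _ (g i))))))))

  result : Parallelogram P
  result with p , q , p<q , eq ← pigeonhole many (λ p → fromℕ< (bound (remQuot l p))) =
    parallelogram
      (λ gi≡gj → Fin.punchInᵢ≢i i j (sym (g-injective _ _ gi≡gj)))
      (distinct ij≢ sums) sums (Pg i) (Pg (punchIn i j)) (Pg i′) (Pg (punchIn i′ j′))
    where
    i  = proj₁ (remQuot {suc l} l p)
    j  = proj₂ (remQuot {suc l} l p)
    i′ = proj₁ (remQuot {suc l} l q)
    j′ = proj₂ (remQuot {suc l} l q)

    sums : g i + g (punchIn i′ j′) ≡ g (punchIn i j) + g i′
    sums = cross {g i} {a′ = g i′} (g≤M (punchIn i j)) (g≤M (punchIn i′ j′)) (Fin.fromℕ<-injective _ _ _ _ eq)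

    ij≢ : remQuot {suc l} l p ≢ remQuot {suc l} l q
    ij≢ same = Fin.<⇒≢ p<q (begin
      p                                     ≡⟨ Fin.combine-remQuot {suc l} l p ⟨
      uncurry combine (remQuot {suc l} l p) ≡⟨ cong (uncurry combine) same ⟩
      uncurry combine (remQuot {suc l} l q) ≡⟨ Fin.combine-remQuot {suc l} l q ⟩
      q                                     ∎)
      where open ≡-Reasoning

-- Corner-free colorings and the third color.

-- The bound keeps the row `s + t + d` of the corner inside the grid; no other coordinate exceeds
-- it.
CornerFree : ∀ {k} → (ℕ → ℕ → Fin k) → ℕ → Set
CornerFree κ n = ∀ s t d → 0 < d → s + t + d < n → κ s t ≡ κ (s + d) t → κ s t ≢ κ s (t + d)

third-color : ∀ (c c′ x y : Fin 3) → c ≢ c′ → x ≢ c → x ≢ c′ → y ≢ c → y ≢ c′ → x ≡ y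
third-color = from-yes (all? {3} λ c → all? {3} λ c′ → all? {3} λ x → all? {3} λ y →
  ¬? (c Fin.≟ c′) →-dec ¬? (x Fin.≟ c) →-dec ¬? (x Fin.≟ c′) →-dec
  ¬? (y Fin.≟ c) →-dec ¬? (y Fin.≟ c′) →-dec x Fin.≟ y)

record Position {k} (κ : ℕ → ℕ → Fin k) (n d : ℕ) (c c′ : Fin k) (a : ℕ) : Set where
  constructor position
  field
    bounded : a + d < n
    start   : κ 0 a ≡ c
    end     : κ 0 (a + d) ≡ c
    corner  : κ d a ≡ c′

module _ {κ : ℕ → ℕ → Fin 3} {n d : ℕ} {c c′ : Fin 3}
         (κ-free : CornerFree κ n) (0<d : 0 < d) (c≢c′ : c ≢ c′) where

  -- Color `c` at `(d + e , a)` would complete a corner of size `d + e` with `(0 , a)` and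
  -- `(0 , b + d)`; color `c′` would complete one of size `e` with `(d , a)` and `(d , b)`.
  forced : ∀ {a b e} → 0 < e → a + e ≡ b → Position κ n d c c′ a → Position κ n d c c′ b →
           κ (d + e) a ≢ c × κ (d + e) a ≢ c′
  forced {a} {e = e} 0<e refl (position _ s _ k) (position b _ t′ k′) =
    (λ eq → κ-free 0 a (d + e) (<-≤-trans 0<d (m≤m+n d e))
      (subst (_< n) (assoc a d e) b) (trans s (sym eq))
      (trans s (sym (trans (cong (κ 0) (sym (assoc a d e))) t′)))) ,
    (λ eq → κ-free d a e 0<e (subst (_< n) (rotate a d e) b)
      (trans k (sym eq)) (trans k (sym k′)))
    where
    assoc : ∀ a d e → a + e + d ≡ a + (d + e)
    assoc = solve-∀

    rotate : ∀ a d e → a + e + d ≡ d + a + e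
    rotate = solve-∀

  no-parallelogram : ¬ Parallelogram (Position κ n d c c′)
  no-parallelogram (a , e , f , 0<e , 0<f , p , pₑ , p_f , pₑf) =
    -- The three points get the third color from the pairs of positions `a`, `a + e`; `a`,
    -- `a + e + f`; and `a + f`, `a + e + f`.
    κ-free (d + e) a f 0<f (subst (_< n) (rotate a d e f) (Position.bounded pₑf))
      (agree (forced 0<e refl p pₑ)
        (subst (λ s → κ s a ≢ c × κ s a ≢ c′) (sym (+-assoc d e f))
          (forced (<-≤-trans 0<e (m≤m+n e f)) (sym (+-assoc a e f)) p pₑf)))
      (agree (forced 0<e refl p pₑ) (forced 0<e (swap a e f) p_f pₑf))
    where
    agree : ∀ {x y} → x ≢ c × x ≢ c′ → y ≢ c × y ≢ c′ → x ≡ y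
    agree (x≢c , x≢c′) (y≢c , y≢c′) = third-color c c′ _ _ c≢c′ x≢c x≢c′ y≢c y≢c′

    rotate : ∀ a d e f → a + e + f + d ≡ d + e + a + f
    rotate = solve-∀

    swap : ∀ a e f → a + f + e ≡ a + e + f
    swap = solve-∀

-- Counting monochromatic pairs on the diagonal.

pairs : List (Fin 7 × Fin 7)
pairs = filter (λ (p , q) → p Fin.<? q) (cartesianProduct (allFin 7) (allFin 7))

∀-vec? : ∀ k m {P : Vec (Fin k) m → Set} → Decidable P → Dec (∀ v → P v)
∀-vec? k zero    P? = map′ (λ { p [] → p }) (λ p → p []) (P? [])
∀-vec? k (suc m) P? = map′ (λ { p (x ∷ v) → p x v }) (λ p x v → p (x ∷ v))
  (all? λ x → ∀-vec? k m (λ v → P? (x ∷ v)))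

monochromatic? : ∀ (f : Fin 7 → Fin 3) → Decidable (λ ((p , q) : Fin 7 × Fin 7) → f p ≡ f q)
monochromatic? f (p , q) = f p Fin.≟ f q

-- The most even split of seven points, 3 + 2 + 2, leaves 3 + 1 + 1 pairs. The proof checks all
-- colorings, listed as vectors and compared with `f` pointwise.
monochromatic-pairs : ∀ f → 5 ≤ length (filter (monochromatic? f) pairs)
monochromatic-pairs f = subst (λ ps → 5 ≤ length ps)
  (filter-≐ (monochromatic? _) (monochromatic? f)
    ( (λ {(p , q)} eq → trans (sym (f≗ p)) (trans eq (f≗ q)))
    , (λ {(p , q)} eq → trans (f≗ p) (trans eq (sym (f≗ q)))))
    pairs)
  (exhaustive (Vec.tabulate f))
  where
  f≗ : Vec.lookup (Vec.tabulate f) ≗ f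
  f≗ = lookup∘tabulate f

  exhaustive : ∀ (v : Vec (Fin 3) 7) → 5 ≤ length (filter (monochromatic? (Vec.lookup v)) pairs)
  exhaustive = from-yes (∀-vec? 3 7 λ v → 5 ≤? length (filter (monochromatic? (Vec.lookup v)) pairs))

colors : List (Fin 3 × Fin 3)
colors = filter (λ (c , c′) → ¬? (c Fin.≟ c′)) (cartesianProduct (allFin 3) (allFin 3))

module _ {κ : ℕ → ℕ → Fin 3} (κ-free : CornerFree κ 1573) where

  few-positions : ∀ {d c c′} → 0 < d → c ≢ c′ → ∀ {xs} → Unique xs → All (Position κ 1573 d c c′) xs →
                  length xs ≤ 62
  few-positions 0<d c≢c′ {xs} xs! positions = ≮⇒≥ λ many →
    no-parallelogram κ-free 0<d c≢c′
      (dense⇒parallelogram 1573 xs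
        -- 3147 = 2 · 1573 + 1 is the number of possible shifted differences.
        (<-≤-trans (from-yes (3147 <? 63 * 62)) (*-mono-≤ many (pred-mono-≤ many)))
        xs!
        (All.map (λ pos → ≤-trans (m≤m+n _ _) (<⇒≤ (Position.bounded pos))) positions)
        positions)

  -- Here 372 = 6 · 62: each `a` is a position for one of the six ordered pairs of distinct colors,
  -- and each pair admits at most 62 positions.
  few-monochromatic : ∀ {d} → 0 < d → ∀ {xs} → Unique xs → All (λ a → a + d < 1573) xs →
                      All (λ a → κ 0 a ≡ κ 0 (a + d)) xs → length xs ≤ 372
  few-monochromatic {d} 0<d {xs} xs! bounded mono = ≮⇒≥ many⇒⊥
    where
    typed? : ∀ a ((c , c′) : Fin 3 × Fin 3) → Dec (κ 0 a ≡ c × κ d a ≡ c′)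
    typed? a (c , c′) = (κ 0 a Fin.≟ c) ×-dec (κ d a Fin.≟ c′)

    -- κ 0 a ≢ κ d a, since (0 , a), (d , a), (0 , a + d) would otherwise be a corner.
    has-type : ∀ a → a ∈ xs → 1 ≤ length (filter (typed? a) colors)
    has-type a a∈ = ∈-length (∈-filter⁺ (typed? a)
      (∈-filter⁺ (λ (c , c′) → ¬? (c Fin.≟ c′)) (∈-cartesianProduct⁺ (∈-allFin _) (∈-allFin _))
        λ κ₀≡κd → κ-free 0 a d 0<d (All.lookup bounded a∈) κ₀≡κd (All.lookup mono a∈))
      (refl , refl))

    many⇒⊥ : ¬ 372 < length xs
    many⇒⊥ many
      with (c , c′) , cc′∈ , many′ ← popular typed? 1 62 xs colors has-type
             (subst (372 <_) (sym (*-identityʳ _)) many)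
      with _ , c≢c′ ← ∈-filter⁻ (λ (c , c′) → ¬? (c Fin.≟ c′))
                        {xs = cartesianProduct (allFin 3) (allFin 3)} cc′∈ =
      <⇒≱ many′ (few-positions 0<d c≢c′ (Unique.filter⁺ _ xs!) (All.tabulate located))
      where
      located : ∀ {a} → a ∈ filter (λ a → typed? a (c , c′)) xs → Position κ 1573 d c c′ a
      located a∈ with a∈xs , κ₀≡c , κd≡c′ ← ∈-filter⁻ (λ a → typed? a (c , c′)) {xs = xs} a∈ =
        position (All.lookup bounded a∈xs) κ₀≡c
          (trans (sym (All.lookup mono a∈xs)) κ₀≡c) κd≡c′

  -- 1567 = 1573 - 6 windows fit on the diagonal, and each has 21 pairs.
  few-windows : ∀ {ws} → Unique ws → All (_< 1567) ws → length ws ≢ 1567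
  few-windows {ws} ws! ws< |ws| = many⇒⊥ (popular same? 5 372 ws pairs
    (λ w _ → monochromatic-pairs (λ p → κ 0 (w + toℕ p)))
    (subst (λ l → 21 * 372 < l * 5) (sym |ws|) (from-yes (21 * 372 <? 1567 * 5))))
    where
    same? : ∀ w ((p , q) : Fin 7 × Fin 7) → Dec (κ 0 (w + toℕ p) ≡ κ 0 (w + toℕ q))
    same? w = monochromatic? (λ p → κ 0 (w + toℕ p))

    many⇒⊥ : ¬ (∃[ pq ] pq ∈ pairs × 372 < length (filter (λ w → same? w pq) ws))
    -- Shifting the windows by `p` turns them into starting points of monochromatic pairs with the
    -- common difference `q - p`.
    many⇒⊥ (pq@(p , q) , pq∈ , many) =
      <⇒≱ many (subst (_≤ 372) (length-map (_+ toℕ p) (filter (λ w → same? w pq) ws))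
        (few-monochromatic (m<n⇒0<n∸m p<q)
          (Unique.map⁺ (+-cancelʳ-≡ (toℕ p) _ _) (Unique.filter⁺ (λ w → same? w pq) ws!))
          (All.map⁺ (All.map bounded (All.filter⁺ (λ w → same? w pq) ws<)))
          (All.map⁺ (All.map (λ {w} eq → trans eq (cong (κ 0) (sym (shift w))))
            (All.all-filter (λ w → same? w pq) ws)))))
      where
      p<q : toℕ p < toℕ q
      p<q = proj₂ (∈-filter⁻ (λ (p , q) → p Fin.<? q) {xs = cartesianProduct (allFin 7) (allFin 7)} pq∈)

      shift : ∀ w → w + toℕ p + (toℕ q ∸ toℕ p) ≡ w + toℕ q
      shift w = trans (+-assoc w _ _) (cong (w +_) (m+[n∸m]≡n (<⇒≤ p<q)))

      bounded : ∀ {w} → w < 1567 → w + toℕ p + (toℕ q ∸ toℕ p) < 1573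
      bounded {w} w< = subst (_< 1573) (sym (shift w)) (+-mono-<-≤ w< (s≤s⁻¹ (toℕ<n q)))

  ¬cornerFree-1573 : ⊥
  ¬cornerFree-1573 = few-windows (Unique.upTo⁺ 1567) (All.all-upTo 1567) (length-upTo 1567)

-- Decidability of unavoidability.

module _ {k n : ℕ} where

  -- The existential over ℕ needs no search, as `p` and `q` determine `x`, `y` and `d`.
  isL? : ∀ (p q r : Grid n) → Dec (IsL p q r)
  isL? p@(i , j) q@(i′ , j′) r@(i″ , j″) = map′ to from
    ((toℕ i <? toℕ i′) ×-dec (toℕ j′ ≟ toℕ j) ×-dec (toℕ i″ ≟ toℕ i′) ×-dec
     (toℕ j″ ≟ toℕ j + (toℕ i′ ∸ toℕ i)))
    where
    to : toℕ i < toℕ i′ × toℕ j′ ≡ toℕ j × toℕ i″ ≡ toℕ i′ × toℕ j″ ≡ toℕ j + (toℕ i′ ∸ toℕ i) → IsL p q r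
    to (i<i′ , j′≡ , i″≡ , j″≡) =
      toℕ i , toℕ j , toℕ i′ ∸ toℕ i , m<n⇒0<n∸m i<i′ , (refl , refl) ,
      (i′≡ , j′≡) , (trans i″≡ i′≡ , j″≡)
      where i′≡ = sym (m+[n∸m]≡n (<⇒≤ i<i′))

    from : IsL p q r → toℕ i < toℕ i′ × toℕ j′ ≡ toℕ j × toℕ i″ ≡ toℕ i′ × toℕ j″ ≡ toℕ j + (toℕ i′ ∸ toℕ i)
    from (x , y , d , d>0 , (refl , refl) , (i′≡ , j′≡) , (i″≡ , j″≡)) =
      subst (toℕ i <_) (sym i′≡) (m<m+n _ d>0) , j′≡ , trans i″≡ (sym i′≡) ,
      trans j″≡ (cong (toℕ j +_) (sym (trans (cong (_∸ toℕ i) i′≡) (m+n∸m≡n (toℕ i) d))))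

  anyGrid? : ∀ {P : Grid n → Set} → Decidable P → Dec (∃[ p ] P p)
  anyGrid? P? = map′ (λ (i , j , p) → (i , j) , p) (λ ((i , j) , p) → i , j , p)
    (Fin.any? λ i → Fin.any? λ j → P? (i , j))

  hasMonochromaticL? : ∀ (c : Coloring k n) → Dec (HasMonochromaticL c)
  hasMonochromaticL? c = anyGrid? λ p → anyGrid? λ q → anyGrid? λ r →
    isL? p q r ×-dec (c p Fin.≟ c q) ×-dec (c q Fin.≟ c r)

  hasMonochromaticL-resp-≗ : ∀ {c c′ : Coloring k n} → c ≗ c′ → HasMonochromaticL c → HasMonochromaticL c′
  hasMonochromaticL-resp-≗ c≗c′ (p , q , r , isL , pq , qr) =
    p , q , r , isL , trans (sym (c≗c′ p)) (trans pq (c≗c′ q)) , trans (sym (c≗c′ q)) (trans qr (c≗c′ r))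

-- Up to pointwise equality, which preserves monochromatic Ls, the colorings are coded by the
-- numbers below `k ^ (n * n)`.
unavoidable? : ∀ k n → Dec (Unavoidable k n)
unavoidable? k n = map′
  (λ all c → hasMonochromaticL-resp-≗ (decode-encode c) (all (encode c)))
  (λ unavoidable i → unavoidable (decode i))
  (all? λ i → hasMonochromaticL? (decode i))
  where
  decode : Fin (k ^ (n * n)) → Coloring k n
  decode i (x , y) = finToFun i (combine x y)

  encode : Coloring k n → Fin (k ^ (n * n))
  encode c = funToFin (c ∘ remQuot n)

  decode-encode : ∀ c → decode (encode c) ≗ c
  decode-encode c (x , y) = trans (Fin.finToFun-funToFin (c ∘ remQuot n) (combine x y))
    (cong c (Fin.remQuot-combine x y))

-- Return to the grid and existence of the least size.

-- Reduction `mod n` only makes the coloring total: within the bound of `CornerFree` every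
-- coordinate is below `n`, so nothing wraps around.
cornerFree : ∀ {k n} .{{_ : NonZero n}} (c : Coloring k n) → ¬ HasMonochromaticL c →
             CornerFree (λ s t → c ((s + t) mod n , t mod n)) n
cornerFree {n = n} c ¬mono s t d 0<d bound eq₁ eq₂ = ¬mono
  ( ((s + t) mod n , t mod n) , ((s + d + t) mod n , t mod n) , ((s + (t + d)) mod n , (t + d) mod n)
  , ( s + t , t , d , 0<d
    , (toℕ-mod (≤-<-trans (m≤m+n _ d) bound) , toℕ-mod t<n)
    , (trans (toℕ-mod (subst (_< n) (swap s t d) bound)) (sym (swap s t d)) , toℕ-mod t<n)
    , (trans (toℕ-mod (subst (_< n) (+-assoc s t d) bound)) (sym (+-assoc s t d)) , toℕ-mod t+d<n))
  , eq₁ , trans (sym eq₁) eq₂)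
  where
  toℕ-mod : ∀ {m} → m < n → toℕ (m mod n) ≡ m
  toℕ-mod m<n = trans (Fin.toℕ-fromℕ< _) (m<n⇒m%n≡m m<n)

  swap : ∀ s t d → s + t + d ≡ s + d + t
  swap = solve-∀

  t+d<n : t + d < n
  t+d<n = ≤-<-trans (m≤n+m (t + d) s) (subst (_< n) (+-assoc s t d) bound)

  t<n : t < n
  t<n = ≤-<-trans (m≤m+n t d) t+d<n

unavoidable-1573 : Unavoidable 3 1573
-- Refuting avoidance suffices, since a finite search decides whether `c` has a monochromatic L.
unavoidable-1573 c = decidable-stable (hasMonochromaticL? c) λ ¬mono → ¬cornerFree-1573 (cornerFree c ¬mono)

-- Strong induction: decidability of `P` either yields a smaller witness to descend to or shows that
-- `n` is least.
least-below : ∀ {P : ℕ → Set} → Decidable P → ∀ n → P n →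
              ∃[ m ] (P m × (∀ l → P l → m ≤ l) × m ≤ n)
least-below {P} P? = <-rec _ step
  where
  step : ∀ n → (∀ {m} → m < n → P m → ∃[ l ] (P l × (∀ l′ → P l′ → l ≤ l′) × l ≤ m)) →
         P n → ∃[ m ] (P m × (∀ l → P l → m ≤ l) × m ≤ n)
  step n rec Pn with anyUpTo? P? n
  ... | yes (m , m<n , Pm) with l , Pl , least , l≤m ← rec m<n Pm = l , Pl , least , ≤-trans l≤m (<⇒≤ m<n)
  ... | no ∄m = n , Pn , (λ l Pl → ≮⇒≥ λ l<n → ∄m (l , l<n , Pl)) , ≤-refl

ramsey-≤ : ∀ {k n} → 0 < n → Unavoidable k n → ∃[ R ] (IsRamseyL k R × R ≤ n)
ramsey-≤ {k} {n} 0<n unavoidable-n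
  with R , (R>0 , unavoidable) , least , R≤n ←
    least-below (λ m → (0 <? m) ×-dec unavoidable? k m) n (0<n , unavoidable-n) =
  R , record { positive = R>0 ; unavoidable = unavoidable ; least = λ m m>0 u → least m (m>0 , u) } , R≤n

theorem4 : ∃[ R ] (IsRamseyL 3 R × R ≤ 1573)
theorem4 = ramsey-≤ z<s unavoidable-1573
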